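{- Assume Vopěnka's Principle. Let $R$ be a ring and let $\mathcal{B}$ be a class of $R$-modules such that ${}^\perp B$ is downward closed under elementary submodules for every $B\in\mathcal{B}$. Then there is a set $\mathcal{B}_0\subseteq\mathcal{B}$ such that ${}^\perp\mathcal{B}={}^\perp\mathcal{B}_0$.
   Context: The background theory is ZFC. Modules are left $R$-modules. For a class $\mathcal{C}$ of $R$-modules, ${}^\perp\mathcal{C}=\{X : \mathrm{Ext}^1_R(X,C)=0 \text{ for all } C\in\mathcal{C}\}$; for a single module $B$, ${}^\perp B={}^\perp\{B\}$. "Set" is as opposed to a proper class. The language of $R$-modules is the language of abelian groups together with a unary function symbol for scalar multiplication by $r$, for each $r\in R$. An elementary submodule is an elementary substructure in this language. A class $\mathcal{K}$ of modules is downward closed under elementary submodules if $M\in\mathcal{K}$ and $N\prec M$ imply $N\in\mathcal{K}$. Vopěnka's Principle is the axiom scheme asserting that for every proper class (definable with parameters) of structures in a common first-order signature (a set), there are two distinct members of the class with an elementary embedding from one into the other. Classes are definable with parameters, and assertions about all classes are understood as schemes. -}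

-- Sets are the types in a fixed universe Set ℓ; a set equipped with an equality
-- is a setoid there, as everywhere in the standard library's algebra hierarchy.
-- Classes are predicates valued in the next universe, so a class variable ranges
-- over all classes, which renders the quantification over classes in a scheme.

module Defs where

open import Level using (Level) renaming (suc to lsuc)
open import Algebra.Bundles using (Ring)
open import Algebra.Module.Bundles using (LeftModule)
open import Algebra.Module.Bundles.Raw using (RawLeftModule)
import Algebra.Module.Construct.DirectProduct as DirectProduct
import Algebra.Module.Morphism.Construct.Composition as Composition
import Algebra.Module.Morphism.Construct.Identity as Identity
import Algebra.Module.Morphism.LeftModuleMonomorphism as LeftModuleMonomorphism
open import Algebra.Module.Morphism.Structures
  using (IsLeftModuleHomomorphism; IsLeftModuleMonomorphism; IsLeftModuleIsomorphism)
open import Data.Empty.Polymorphic using (⊥)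
open import Data.Fin.Base using (Fin; zero; suc)
open import Data.Nat.Base using (ℕ; suc)
open import Data.Product.Base using (Σ; Σ-syntax; ∃; ∃-syntax; _×_; _,_; proj₁; proj₂)
open import Data.Vec.Functional using (Vector; _∷_)
open import Function.Base using (_∘_)
open import Function.Bundles using (_⇔_)
open import Function.Definitions using (StrictlySurjective)
open import Relation.Binary.Bundles using (Setoid)
open import Relation.Binary.PropositionalEquality.Core using (_≡_; _≢_)
open import Relation.Nullary.Negation.Core using (¬_)
open import Relation.Unary using (Pred; _≐_)

private
  variable
    ℓ : Level

------------------------------------------------------------------------
-- Sets and proper classes

Class : Set (lsuc ℓ) → Set (lsuc (lsuc ℓ))
Class {ℓ} X = Pred X (lsuc ℓ)

-- A class is a set when it is the range of a function defined on a set
-- (replacement).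

IsSet : {X : Set (lsuc ℓ)} → Class X → Set (lsuc ℓ)
IsSet {ℓ} {X} 𝒞 = Σ[ I ∈ Set ℓ ] Σ[ F ∈ (I → X) ] 𝒞 ≐ (λ x → ∃[ i ] F i ≡ x)

IsProper : {X : Set (lsuc ℓ)} → Class X → Set (lsuc ℓ)
IsProper 𝒞 = ¬ IsSet 𝒞

------------------------------------------------------------------------
-- First-order logic

record Signature ℓ : Set (lsuc ℓ) where
  field
    Func  : Set ℓ
    Rel   : Set ℓ
    arity : Func → ℕ
    rank  : Rel → ℕ

record Structure (L : Signature ℓ) : Set (lsuc ℓ) where
  open Signature L
  field
    setoid : Setoid ℓ ℓ
  open Setoid setoid public
  field
    func      : (f : Func) → Vector Carrier (arity f) → Carrier
    rel       : (r : Rel) → Vector Carrier (rank r) → Set ℓ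
    func-cong : ∀ f {v w} → (∀ i → v i ≈ w i) → func f v ≈ func f w
    rel-resp  : ∀ r {v w} → (∀ i → v i ≈ w i) → rel r v → rel r w

module _ (L : Signature ℓ) where
  open Signature L

  -- The free variables of a term or formula are indexed by Fin n.

  data Term (n : ℕ) : Set ℓ where
    var : Fin n → Term n
    app : (f : Func) → (Fin (arity f) → Term n) → Term n

  -- The remaining connectives and ∃ are definable from these classically.

  data Formula (n : ℕ) : Set ℓ where
    _≈ᶠ_ : Term n → Term n → Formula n
    relᶠ : (r : Rel) → (Fin (rank r) → Term n) → Formula n
    ⊥ᶠ   : Formula n
    _⇒ᶠ_ : Formula n → Formula n → Formula n
    ∀ᶠ   : Formula (suc n) → Formula n

module _ {L : Signature ℓ} where

  module _ (S : Structure L) where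
    open Structure S

    ⟦_⟧ : ∀ {n} → Term L n → Vector Carrier n → Carrier
    ⟦ var i ⟧ v    = v i
    ⟦ app f ts ⟧ v = func f (λ i → ⟦ ts i ⟧ v)

    Sat : ∀ {n} → Formula L n → Vector Carrier n → Set ℓ
    Sat (s ≈ᶠ t) v    = ⟦ s ⟧ v ≈ ⟦ t ⟧ v
    Sat (relᶠ r ts) v = rel r (λ i → ⟦ ts i ⟧ v)
    Sat ⊥ᶠ v          = ⊥
    Sat (φ ⇒ᶠ ψ) v    = Sat φ v → Sat ψ v
    Sat (∀ᶠ φ) v      = (a : Carrier) → Sat φ (a ∷ v)

  -- Such an h respects the equalities: take φ to be an equation between variables.

  IsElementaryEmbedding : (S T : Structure L) →
                          (Structure.Carrier S → Structure.Carrier T) → Set ℓ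
  IsElementaryEmbedding S T h =
    ∀ {n} (φ : Formula L n) v → Sat S φ v ⇔ Sat T φ (h ∘ v)

VopěnkaPrinciple : ∀ ℓ → Set (lsuc (lsuc ℓ))
VopěnkaPrinciple ℓ =
  (L : Signature ℓ) (𝒞 : Class (Structure L)) → IsProper 𝒞 →
  ∃[ S ] ∃[ T ] 𝒞 S × 𝒞 T × S ≢ T × ∃ (IsElementaryEmbedding S T)

------------------------------------------------------------------------
-- Elementary submodules

module _ (R : Ring ℓ ℓ) where
  open Ring R using (Carrier)

  data ModuleFunc : Set ℓ where
    plus zero neg : ModuleFunc
    scale         : Carrier → ModuleFunc

  ModuleSignature : Signature ℓ
  ModuleSignature = record
    { Func  = ModuleFunc
    ; Rel   = ⊥
    ; arity = λ { plus → 2 ; zero → 0 ; neg → 1 ; (scale _) → 1 }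
    ; rank  = λ ()
    }

module _ {R : Ring ℓ ℓ} where
  open Ring R using (Carrier; isRing)

  asStructure : LeftModule R ℓ ℓ → Structure (ModuleSignature R)
  asStructure M = record
    { setoid    = ≈ᴹ-setoid
    ; func      = λ { plus v      → v zero +ᴹ v (suc zero)
                    ; zero _      → 0ᴹ
                    ; neg v       → -ᴹ v zero
                    ; (scale r) v → r *ₗ v zero
                    }
    ; rel       = λ ()
    ; func-cong = λ { plus eq      → +ᴹ-cong (eq zero) (eq (suc zero))
                    ; zero _       → ≈ᴹ-refl
                    ; neg eq       → -ᴹ‿cong (eq zero)
                    ; (scale r) eq → *ₗ-congˡ (eq zero)
                    }
    ; rel-resp  = λ ()
    }
    where open LeftModule M

  record Submodule (M : LeftModule R ℓ ℓ) : Set (lsuc ℓ) where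
    open LeftModule M
    field
      member    : Pred Carrierᴹ ℓ
      resp      : ∀ {x y} → x ≈ᴹ y → member x → member y
      +ᴹ-closed : ∀ {x y} → member x → member y → member (x +ᴹ y)
      0ᴹ-closed : member 0ᴹ
      -ᴹ-closed : ∀ {x} → member x → member (-ᴹ x)
      *ₗ-closed : ∀ r {x} → member x → member (r *ₗ x)

  ⌊_⌋ : {M : LeftModule R ℓ ℓ} → Submodule M → LeftModule R ℓ ℓ
  ⌊_⌋ {M} N = record
    { RawLeftModule raw
    ; isLeftModule = LeftModuleMonomorphism.isLeftModule inclusion isRing isLeftModule
    }
    where
    open LeftModule M
    open Submodule N
    raw : RawLeftModule Carrier ℓ ℓ
    raw = record
      { Carrierᴹ = Σ Carrierᴹ member
      ; _≈ᴹ_     = λ x y → proj₁ x ≈ᴹ proj₁ y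
      ; _+ᴹ_     = λ x y → proj₁ x +ᴹ proj₁ y , +ᴹ-closed (proj₂ x) (proj₂ y)
      ; _*ₗ_     = λ r x → r *ₗ proj₁ x , *ₗ-closed r (proj₂ x)
      ; 0ᴹ       = 0ᴹ , 0ᴹ-closed
      ; -ᴹ_      = λ x → -ᴹ proj₁ x , -ᴹ-closed (proj₂ x)
      }
    inclusion : IsLeftModuleMonomorphism raw rawLeftModule proj₁
    inclusion = record
      { isLeftModuleHomomorphism = record
        { +ᴹ-isGroupHomomorphism = record
          { isMonoidHomomorphism = record
            { isMagmaHomomorphism = record
              { isRelHomomorphism = record { cong = λ eq → eq }
              ; homo              = λ _ _ → ≈ᴹ-refl
              }
            ; ε-homo = ≈ᴹ-refl
            }
          ; ⁻¹-homo = λ _ → ≈ᴹ-refl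
          }
        ; *ₗ-homo = λ _ _ → ≈ᴹ-refl
        }
      ; injective = λ eq → eq
      }

  IsElementary : {M : LeftModule R ℓ ℓ} → Submodule M → Set ℓ
  IsElementary {M} N = IsElementaryEmbedding (asStructure ⌊ N ⌋) (asStructure M) proj₁

  DownwardClosed : Class (LeftModule R ℓ ℓ) → Set (lsuc ℓ)
  DownwardClosed 𝒦 = ∀ {M} → 𝒦 M → (N : Submodule M) → IsElementary N → 𝒦 ⌊ N ⌋

------------------------------------------------------------------------
-- Ext¹

-- Ext¹ (X , C) is Yoneda's: the extensions 0 → C → E → X → 0 up to isomorphism
-- over X and under C, with the split extension as zero.

module _ {R : Ring ℓ ℓ} where
  open LeftModule using (Carrierᴹ; rawLeftModule)

  record Extension (X C : LeftModule R ℓ ℓ) : Set (lsuc ℓ) where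
    private
      module X = LeftModule X
      module C = LeftModule C
    field
      middle : LeftModule R ℓ ℓ
    open LeftModule middle using (_≈ᴹ_) renaming (Carrierᴹ to E; rawLeftModule to rawE)
    field
      incl         : C.Carrierᴹ → E
      incl-mono    : IsLeftModuleMonomorphism C.rawLeftModule rawE incl
      proj         : E → X.Carrierᴹ
      proj-hom     : IsLeftModuleHomomorphism rawE X.rawLeftModule proj
      proj-surj    : StrictlySurjective X._≈ᴹ_ proj
      proj∘incl    : ∀ c → proj (incl c) X.≈ᴹ X.0ᴹ
      ker-proj⊆im  : ∀ e → proj e X.≈ᴹ X.0ᴹ → ∃[ c ] incl c ≈ᴹ e

  record Equivalent {X C : LeftModule R ℓ ℓ} (𝓔 𝓕 : Extension X C) : Set ℓ where
    private
      module X = LeftModule X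
      module E = Extension 𝓔
      module F = Extension 𝓕
    field
      to      : Carrierᴹ E.middle → Carrierᴹ F.middle
      to-iso  : IsLeftModuleIsomorphism (rawLeftModule E.middle) (rawLeftModule F.middle) to
      to-incl : ∀ c → LeftModule._≈ᴹ_ F.middle (to (E.incl c)) (F.incl c)
      proj-to : ∀ e → F.proj (to e) X.≈ᴹ E.proj e

  module _ (X C : LeftModule R ℓ ℓ) where
    private
      module X = LeftModule X
      module C = LeftModule C

    Equivalent-refl : ∀ {𝓔 : Extension X C} → Equivalent 𝓔 𝓔
    Equivalent-refl {𝓔} = record
      { to      = λ e → e
      ; to-iso  = Identity.isLeftModuleIsomorphism _ E.≈ᴹ-refl
      ; to-incl = λ _ → E.≈ᴹ-refl
      ; proj-to = λ _ → X.≈ᴹ-refl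
      }
      where module E = LeftModule (Extension.middle 𝓔)

    Equivalent-sym : ∀ {𝓔 𝓕 : Extension X C} → Equivalent 𝓔 𝓕 → Equivalent 𝓕 𝓔
    Equivalent-sym {𝓔} {𝓕} eqv = record
      { to      = from
      ; to-iso  = record
        { isLeftModuleMonomorphism = record
          { isLeftModuleHomomorphism = record
            { +ᴹ-isGroupHomomorphism = record
              { isMonoidHomomorphism = record
                { isMagmaHomomorphism = record
                  { isRelHomomorphism = record { cong = from-cong }
                  ; homo = λ x y → I.injective (F.≈ᴹ-trans (to-from _)
                      (F.≈ᴹ-sym (F.≈ᴹ-trans (I.+ᴹ-homo _ _) (F.+ᴹ-cong (to-from x) (to-from y)))))
                  }
                ; ε-homo = I.injective (F.≈ᴹ-trans (to-from _) (F.≈ᴹ-sym I.0ᴹ-homo))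
                }
              ; ⁻¹-homo = λ x → I.injective (F.≈ᴹ-trans (to-from _)
                  (F.≈ᴹ-sym (F.≈ᴹ-trans (I.-ᴹ-homo _) (F.-ᴹ‿cong (to-from x)))))
              }
            ; *ₗ-homo = λ r x → I.injective (F.≈ᴹ-trans (to-from _)
                (F.≈ᴹ-sym (F.≈ᴹ-trans (I.*ₗ-homo r _) (F.*ₗ-congˡ (to-from x)))))
            }
          ; injective = λ {x} {y} eq →
              F.≈ᴹ-trans (F.≈ᴹ-sym (to-from x)) (F.≈ᴹ-trans (I.⟦⟧-cong eq) (to-from y))
          }
        ; surjective = λ e → to e , λ eq →
            E.≈ᴹ-trans (from-cong eq) (I.injective (to-from (to e)))
        }
      ; to-incl = λ c → I.injective (F.≈ᴹ-trans (to-from _) (F.≈ᴹ-sym (to-incl c)))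
      ; proj-to = λ f → X.≈ᴹ-trans (X.≈ᴹ-sym (proj-to (from f))) (proj-cong (to-from f))
      }
      where
      open Equivalent eqv
      module E = LeftModule (Extension.middle 𝓔)
      module F = LeftModule (Extension.middle 𝓕)
      module I = IsLeftModuleIsomorphism to-iso
      open IsLeftModuleHomomorphism (Extension.proj-hom 𝓕) using () renaming (⟦⟧-cong to proj-cong)
      from : F.Carrierᴹ → E.Carrierᴹ
      from f = proj₁ (I.surjective f)
      to-from : ∀ f → to (from f) F.≈ᴹ f
      to-from f = proj₂ (I.surjective f) E.≈ᴹ-refl
      from-cong : ∀ {x y} → x F.≈ᴹ y → from x E.≈ᴹ from y
      from-cong eq = I.injective (F.≈ᴹ-trans (to-from _) (F.≈ᴹ-trans eq (F.≈ᴹ-sym (to-from _))))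

    Equivalent-trans : ∀ {𝓔 𝓕 𝓖 : Extension X C} →
                       Equivalent 𝓔 𝓕 → Equivalent 𝓕 𝓖 → Equivalent 𝓔 𝓖
    Equivalent-trans {𝓖 = 𝓖} p q = record
      { to      = λ e → Q.to (P.to e)
      ; to-iso  = Composition.isLeftModuleIsomorphism G.≈ᴹ-trans P.to-iso Q.to-iso
      ; to-incl = λ c → G.≈ᴹ-trans (IsLeftModuleIsomorphism.⟦⟧-cong Q.to-iso (P.to-incl c))
                                   (Q.to-incl c)
      ; proj-to = λ e → X.≈ᴹ-trans (Q.proj-to (P.to e)) (P.proj-to e)
      }
      where
      module P = Equivalent p
      module Q = Equivalent q
      module G = LeftModule (Extension.middle 𝓖)

    Ext¹ : Setoid (lsuc ℓ) ℓ
    Ext¹ = record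
      { Carrier       = Extension X C
      ; _≈_           = Equivalent
      ; isEquivalence = record
        { refl  = Equivalent-refl
        ; sym   = Equivalent-sym
        ; trans = Equivalent-trans
        }
      }

    split : Extension X C
    split = record
      { middle      = DirectProduct.leftModule C X
      ; incl        = λ c → c , X.0ᴹ
      ; incl-mono   = record
        { isLeftModuleHomomorphism = record
          { +ᴹ-isGroupHomomorphism = record
            { isMonoidHomomorphism = record
              { isMagmaHomomorphism = record
                { isRelHomomorphism = record { cong = λ eq → eq , X.≈ᴹ-refl }
                ; homo              = λ _ _ → C.≈ᴹ-refl , X.≈ᴹ-sym (X.+ᴹ-identityˡ X.0ᴹ)
                }
              ; ε-homo = C.≈ᴹ-refl , X.≈ᴹ-refl
              }
            ; ⁻¹-homo = λ _ → C.≈ᴹ-refl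
                            , X.≈ᴹ-trans (X.≈ᴹ-sym (X.-ᴹ‿inverseʳ X.0ᴹ)) (X.+ᴹ-identityˡ _)
            }
          ; *ₗ-homo = λ r _ → C.≈ᴹ-refl , X.≈ᴹ-sym (X.*ₗ-zeroʳ r)
          }
        ; injective = proj₁
        }
      ; proj        = proj₂
      ; proj-hom    = record
        { +ᴹ-isGroupHomomorphism = record
          { isMonoidHomomorphism = record
            { isMagmaHomomorphism = record
              { isRelHomomorphism = record { cong = proj₂ }
              ; homo              = λ _ _ → X.≈ᴹ-refl
              }
            ; ε-homo = X.≈ᴹ-refl
            }
          ; ⁻¹-homo = λ _ → X.≈ᴹ-refl
          }
        ; *ₗ-homo = λ _ _ → X.≈ᴹ-refl
        }
      ; proj-surj   = λ x → (C.0ᴹ , x) , X.≈ᴹ-refl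
      ; proj∘incl   = λ _ → X.≈ᴹ-refl
      ; ker-proj⊆im = λ e eq → proj₁ e , C.≈ᴹ-refl , X.≈ᴹ-sym eq
      }

    Ext¹≈0 : Set (lsuc ℓ)
    Ext¹≈0 = ∀ 𝓔 → 𝓔 ≈ split
      where open Setoid Ext¹

  infix 8 ^⊥_

  ^⊥_ : Class (LeftModule R ℓ ℓ) → Class (LeftModule R ℓ ℓ)
  (^⊥ 𝒞) X = ∀ {C} → 𝒞 C → Ext¹≈0 X C

{-# OPTIONS --safe #-}
-- Suppose that no set of members of 𝓑 has the same left Ext-orthogonal class as 𝓑.
-- Recursion over the ordinals yields modules X_t and B_t ∈ 𝓑 such that
-- Ext¹ (X_t , B_s) = 0 for s < t but Ext¹ (X_t , B_t) ≠ 0.  Vopěnka's Principle,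
-- applied to the modules X_t coupled with a ranked set of height t + 1, gives s ≠ t and
-- an elementary embedding of X_s into X_t; the coupled ranks force s < t.  The
-- image of X_s is an elementary submodule of X_t ∈ ^⊥ ｛ B_s ｝, so
-- Ext¹ (X_s , B_s) = 0, a contradiction.

module Submission where

open import Defs
open import Level using (Level; suc)
open import Algebra.Bundles using (Ring)
open import Algebra.Module.Bundles using (LeftModule)
import Algebra.Module.Morphism.Construct.Composition as Composition
open import Algebra.Module.Morphism.Structures
  using (IsLeftModuleHomomorphism; IsLeftModuleMonomorphism; IsLeftModuleIsomorphism)
open import Axiom.DoubleNegationElimination using (em⇒dne)
open import Axiom.ExcludedMiddle using (ExcludedMiddle)
open import Axiom.Extensionality.Propositional using (Extensionality)
open import Data.Bool.Base using (Bool; T)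
import Data.Fin.Base as Fin
open import Data.Maybe.Base using (Maybe; just; nothing)
open import Data.Product.Base using (Σ; Σ-syntax; ∃; ∃-syntax; _×_; _,_; proj₁; proj₂)
open import Data.Product.Relation.Binary.Pointwise.NonDependent using (_×ₛ_)
open import Data.Sum.Base using (_⊎_; inj₁; inj₂; [_,_])
open import Data.Vec.Functional using (_∷_; [])
open import Function.Base using (_∘_; const; id)
open import Function.Bundles using (_⇔_; mk⇔; Equivalence)
open import Function.Construct.Composition using (_⇔-∘_)
open import Function.Construct.Identity using (⇔-id)
open import Function.Construct.Symmetry using (⇔-sym)
open import Function.Related.TypeIsomorphisms using (→-cong-⇔)
open import Induction.WellFounded using (WellFounded; Acc; acc; module All; module FixPoint)
open import Relation.Binary.Core using (Rel)
open import Relation.Binary.PropositionalEquality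
  using (_≡_; _≢_; refl; sym; trans; cong; subst; subst₂; setoid)
open import Relation.Binary.Structures using (IsEquivalence)
open import Relation.Nullary.Decidable
  using (Dec; yes; no; isYes; isYes≗does; does-⇔; toWitness; fromWitness; decidable-stable)
open import Relation.Nullary.Negation using (¬_; contradiction)
open import Relation.Unary using (_⊆_; _≐_; ｛_｝)

private
  variable
    a r ℓ : Level

-- Ordinals as well-founded trees compared by rank

data Tree ℓ : Set (suc ℓ) where
  sup : (I : Set ℓ) → (I → Tree ℓ) → Tree ℓ

infix 4 _≤_ _<_ _≃_

-- The rank of `sup I f` is the least ordinal above the ranks of all `f i`; unfolding this gives
-- both recursions. Trees of different shape may share a rank, so `≤` is only a preorder.
_≤_ _<_ _≃_ : Rel (Tree ℓ) ℓ
sup _ f ≤ t = ∀ i → f i < t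
s < sup _ g = ∃[ j ] s ≤ g j
s ≃ t = s ≤ t × t ≤ s

≤-refl : (t : Tree ℓ) → t ≤ t
≤-refl (sup _ f) i = i , ≤-refl (f i)

≤-trans : (s t u : Tree ℓ) → s ≤ t → t ≤ u → s ≤ u
<-≤-trans : (s t u : Tree ℓ) → s < t → t ≤ u → s < u
≤-<-trans : (s t u : Tree ℓ) → s ≤ t → t < u → s < u
≤-trans (sup _ f) t u s≤t t≤u i = <-≤-trans (f i) t u (s≤t i) t≤u
<-≤-trans s (sup _ g) u (j , s≤gj) t≤u = ≤-<-trans s (g j) u s≤gj (t≤u j)
≤-<-trans s t (sup _ h) s≤t (k , t≤hk) = k , ≤-trans s t (h k) s≤t t≤hk

<⇒≤ : (s t : Tree ℓ) → s < t → s ≤ t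
<⇒≤ (sup _ f) (sup _ g) (j , s≤gj) i = j , <⇒≤ (f i) (g j) (s≤gj i)

<-irrefl : (t : Tree ℓ) → ¬ t < t
<-irrefl (sup _ f) (i , t≤fi) = <-irrefl (f i) (t≤fi i)

-- Being below `sup I g` bounds `s` by some `g j` without making it a subtree, so the induction on
-- `t` must treat all `s ≤ t` at once.
<-wellFounded : WellFounded (_<_ {ℓ})
<-wellFounded t = acc λ {s} s<t → below t s (<⇒≤ s t s<t)
  where
  below : ∀ t s → s ≤ t → Acc _<_ s
  below (sup _ g) s s≤t = acc λ {r} r<s →
    let (j , r≤gj) = <-≤-trans r s (sup _ g) r<s s≤t in below (g j) r r≤gj

≃-isEquivalence : IsEquivalence (_≃_ {ℓ})
≃-isEquivalence = record
  { refl  = λ {t} → ≤-refl t , ≤-refl t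
  ; sym   = λ (s≤t , t≤s) → t≤s , s≤t
  ; trans = λ {s} {t} {u} (s≤t , t≤s) (t≤u , u≤t) →
      ≤-trans s t u s≤t t≤u , ≤-trans u t s u≤t t≤s
  }

-- The set of nodes of a tree, ordered by rank

Node : Tree ℓ → Set ℓ
Node (sup I f) = Maybe (Σ[ i ∈ I ] Node (f i))

root : (t : Tree ℓ) → Node t
root (sup _ _) = nothing

subtree : (t : Tree ℓ) → Node t → Tree ℓ
subtree t@(sup _ _) nothing        = t
subtree (sup _ f)   (just (i , p)) = subtree (f i) p

subtree-root : (t : Tree ℓ) → subtree t (root t) ≡ t
subtree-root (sup _ _) = refl

subtree-≤ : (t : Tree ℓ) (p : Node t) → subtree t p ≤ t
subtree-≤ t@(sup _ _) nothing        = ≤-refl t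
subtree-≤ t@(sup _ f) (just (i , p)) =
  <⇒≤ _ t (≤-<-trans _ (f i) t (subtree-≤ (f i) p) (i , ≤-refl (f i)))

-- Not the descendant relation: nodes on different branches are compared too. Classically, up to
-- equality of ranks, this is the ordinal `t + 1`.
NodeLess : (t : Tree ℓ) → Rel (Node t) ℓ
NodeLess t p q = subtree t p < subtree t q

-- A strictly increasing map on ordinals never falls below the identity. By induction `k` restricted
-- to the nodes of `f i` dominates that child at its root, and `k` sends the root of the whole tree
-- strictly higher.
strictlyMonotone⇒≤-root : (s : Tree ℓ) (k : Node s → Tree ℓ) →
                         (∀ p q → NodeLess s p q → k p < k q) → s ≤ k (root s)
strictlyMonotone⇒≤-root (sup I f) k k-mono i =
  ≤-<-trans (f i) (k child) (k nothing)
    (strictlyMonotone⇒≤-root (f i) (λ p → k (just (i , p))) (λ p q → k-mono _ _))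
    (k-mono child nothing (i , subst (_≤ f i) (sym (subtree-root (f i))) (≤-refl (f i))))
  where
  child : Node (sup I f)
  child = just (i , root (f i))

nodeEmbedding⇒≤ : (s t : Tree ℓ) (k : Node s → Node t) →
                  (∀ p q → NodeLess s p q → NodeLess t (k p) (k q)) → s ≤ t
nodeEmbedding⇒≤ s t k k-mono = ≤-trans s (subtree t (k (root s))) t
  (strictlyMonotone⇒≤-root s (subtree t ∘ k) k-mono)
  (subtree-≤ t (k (root s)))

-- Burali-Forti: if a set indexed the range, let `u` be the strict supremum of the ranks of its
-- indices. The value at `u` is also the value at some index, whose rank is then both below `u` and
-- at least `u`.
unboundedRange-isProper :
  {A : Set (suc ℓ)} (S : Tree ℓ → A) (rank : Tree ℓ → Tree ℓ) → (∀ t → t ≤ rank t) →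
  (∀ {s t} → S s ≡ S t → rank s ≤ rank t) → IsProper (λ x → ∃[ t ] S t ≡ x)
unboundedRange-isProper {ℓ} S rank t≤rank rank-resp (I , F , ⊆F , F⊆) =
  <-irrefl u (≤-<-trans u (rank u) u (t≤rank u) (≤-<-trans (rank u) (rank (index i)) u
    (rank-resp (sym (trans (proj₂ (F⊆ (i , refl))) Fi≡Su)))
    (i , ≤-refl (rank (index i)))))
  where
  index : I → Tree ℓ
  index i = proj₁ (F⊆ (i , refl))

  u : Tree ℓ
  u = sup I (rank ∘ index)

  covered : ∃[ i ] F i ≡ S u
  covered = ⊆F (u , refl)

  i : I
  i = proj₁ covered

  Fi≡Su : F i ≡ S u
  Fi≡Su = proj₂ covered

-- Linearity of the ranks under excluded middle

module Comparison (em : ∀ {a} → ExcludedMiddle a) where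

  -- Induction on `s` alone: if no child reaches `t`, the induction hypothesis puts every child
  -- strictly below `t`.
  ≤-or-> : (s t : Tree ℓ) → s ≤ t ⊎ t < s
  ≤-or-> (sup I f) t with em {P = ∃[ i ] t ≤ f i}
  ... | yes t<s = inj₂ t<s
  ... | no t≮s  = inj₁ λ i → [ (λ t≤fi → contradiction (i , t≤fi) t≮s) , id ] (≤-or-> t (f i))

  -- Descend into a child that bounds `s` until its rank no longer exceeds that of `s`. Hence the
  -- nodes of `t` form a set that realises every rank below `t`.
  <⇒≃-subtree : (s t : Tree ℓ) → s < t → ∃[ p ] s ≃ subtree t p
  <⇒≃-subtree s (sup _ g) (j , s≤gj) with ≤-or-> (g j) s
  ... | inj₁ gj≤s = just (j , root (g j)) , subst (s ≃_) (sym (subtree-root (g j))) (s≤gj , gj≤s)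
  ... | inj₂ s<gj = let (p , s≃p) = <⇒≃-subtree s (g j) s<gj in just (j , p) , s≃p

-- Excluded middle for all types acts as a choice operator, which depends only on the
-- Boolean predicate; by extensionality equivalent elements have the same predicate.

module Representative
  (em : ∀ {a} → ExcludedMiddle a) (ext : ∀ {a b} → Extensionality a b)
  {A : Set a} {_≈_ : Rel A r} (isEquivalence : IsEquivalence _≈_)
  where

  private
    module ≈ = IsEquivalence isEquivalence

    -- With Boolean values, function extensionality alone makes the classes of equivalent elements
    -- equal; type-valued predicates would need propositional extensionality as well.
    class : A → A → Bool
    class x y = isYes (em {P = x ≈ y})

    class-cong : ∀ {x y} → x ≈ y → class x ≡ class y
    class-cong x≈y = ext λ z → trans (isYes≗does em) (trans
      (does-⇔ (mk⇔ (≈.trans (≈.sym x≈y)) (≈.trans x≈y)) em em)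
      (sym (isYes≗does em)))

    -- The detour through double negation discards the given witness: the result is the one that
    -- excluded middle returns.
    choose : (P : A → Bool) → ∃ (T ∘ P) → ∃ (T ∘ P)
    choose P nonempty = decidable-stable em λ empty → empty nonempty

    decidable-stable-constant : {B : Set a} (B? : Dec B) (p q : ¬ ¬ B) →
                                decidable-stable B? p ≡ decidable-stable B? q
    decidable-stable-constant (yes _)  _ _ = refl
    decidable-stable-constant (no ¬b) p _ = contradiction ¬b p

    choose-cong : ∀ {P Q} → P ≡ Q → ∀ p q → proj₁ (choose P p) ≡ proj₁ (choose Q q)
    choose-cong refl p q = cong proj₁
      (decidable-stable-constant em (λ empty → empty p) (λ empty → empty q))

    inhabited : ∀ x → ∃ (T ∘ class x)
    inhabited x = x , fromWitness ≈.refl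

  rep : A → A
  rep x = proj₁ (choose (class x) (inhabited x))

  ≈-rep : ∀ x → x ≈ rep x
  ≈-rep x = toWitness (proj₂ (choose (class x) (inhabited x)))

  rep-cong : ∀ {x y} → x ≈ y → rep x ≡ rep y
  rep-cong {x} {y} x≈y = choose-cong (class-cong x≈y) (inhabited x) (inhabited y)

-- Canonical ordinals and transfinite choice

module CanonicalTree
  (em : ∀ {a} → ExcludedMiddle a) (ext : ∀ {a b} → Extensionality a b) {ℓ : Level}
  where

  open Comparison em public
  open Representative em ext (≃-isEquivalence {ℓ}) public

  rep-injective : ∀ {s t} → rep s ≤ rep t → rep t ≤ rep s → rep s ≡ rep t
  rep-injective {s} {t} s≤t t≤s = rep-cong (≃.trans (≈-rep s) (≃.trans (s≤t , t≤s) (≃.sym (≈-rep t))))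
    where module ≃ = IsEquivalence ≃-isEquivalence

  -- Each step may look back at only a set of earlier values, but the trees below `t` live in a
  -- larger universe. The representatives of the ranks of nodes of `t` suffice, since every `s < t`
  -- shares its representative with a node. As `x` need not respect `≃`, the conclusion speaks of
  -- `rep s`.
  transfiniteChoice :
    {A : Set a} (_▷_ : A → A → Set r) →
    ({I : Set ℓ} (F : I → A) → ∃[ x ] ∀ i → x ▷ F i) →
    Σ[ x ∈ (Tree ℓ → A) ] (∀ s t → s < t → x t ▷ x (rep s))
  transfiniteChoice {A = A} _▷_ choice = x , x-▷
    where
    -- The inequality excludes nodes of full rank, such as the root, and licenses the recursive
    -- call.
    Below : Tree ℓ → Set ℓ
    Below t = Σ[ p ∈ Node t ] rep (subtree t p) < t

    step : ∀ t → (∀ {s} → s < t → A) → A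
    step t y = proj₁ (choice {Below t} λ (p , p<t) → y p<t)

    x : Tree ℓ → A
    x = All.wfRec <-wellFounded _ (const A) step

    unfold : ∀ t → x t ≡ step t λ {s} _ → x s
    unfold t = FixPoint.unfold-wfRec <-wellFounded (const A) step
      λ t eq → cong (λ F → proj₁ (choice {Below t} F)) (ext λ (p , p<t) → eq p<t)

    x-▷-subtree : ∀ t p {s} → s ≡ rep (subtree t p) → s < t → x t ▷ x s
    x-▷-subtree t p refl s<t = subst (_▷ x (rep (subtree t p))) (sym (unfold t))
      (proj₂ (choice {Below t} λ (q , _) → x (rep (subtree t q))) (p , s<t))

    x-▷ : ∀ s t → s < t → x t ▷ x (rep s)
    x-▷ s t s<t =
      let (p , s≃p) = <⇒≃-subtree s t s<t
      in x-▷-subtree t p (rep-cong s≃p) (≤-<-trans (rep s) s t (proj₂ (≈-rep s)) s<t)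

-- Elementary embeddings

module _ {L : Signature ℓ} (S T : Structure L) where
  private
    module S = Structure S
    module T = Structure T

  -- A relation rather than a map, so that one induction on formulas covers both setoid equality and
  -- the graph of an isomorphism.
  record IsBisimulation (_∼_ : S.Carrier → T.Carrier → Set ℓ) : Set ℓ where
    field
      total      : ∀ x → ∃[ y ] x ∼ y
      surjective : ∀ y → ∃[ x ] x ∼ y
      ≈-resp     : ∀ {x x′ y y′} → x ∼ y → x′ ∼ y′ → x S.≈ x′ ⇔ y T.≈ y′
      func-resp  : ∀ f {v w} → (∀ i → v i ∼ w i) → S.func f v ∼ T.func f w
      rel-resp   : ∀ r {v w} → (∀ i → v i ∼ w i) → S.rel r v ⇔ T.rel r w

    term-resp : ∀ {n} (t : Term L n) {v w} → (∀ i → v i ∼ w i) → ⟦ S ⟧ t v ∼ ⟦ T ⟧ t w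
    term-resp (var i)    v∼w = v∼w i
    term-resp (app f ts) v∼w = func-resp f λ i → term-resp (ts i) v∼w

    Sat-resp : ∀ {n} (φ : Formula L n) {v w} → (∀ i → v i ∼ w i) → Sat S φ v ⇔ Sat T φ w
    Sat-resp (s ≈ᶠ t)    v∼w = ≈-resp (term-resp s v∼w) (term-resp t v∼w)
    Sat-resp (relᶠ r ts) v∼w = rel-resp r λ i → term-resp (ts i) v∼w
    Sat-resp ⊥ᶠ          v∼w = ⇔-id _
    Sat-resp (φ ⇒ᶠ ψ)    v∼w = →-cong-⇔ (Sat-resp φ v∼w) (Sat-resp ψ v∼w)
    Sat-resp (∀ᶠ φ) {v} {w} v∼w = mk⇔
      (λ f y → let (x , x∼y) = surjective y in Equivalence.to (Sat-resp φ (extend x∼y)) (f x))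
      (λ f x → let (y , x∼y) = total x in Equivalence.from (Sat-resp φ (extend x∼y)) (f y))
      where
      extend : ∀ {x y} → x ∼ y → ∀ i → (x ∷ v) i ∼ (y ∷ w) i
      extend x∼y Fin.zero    = x∼y
      extend x∼y (Fin.suc i) = v∼w i

module _ {L : Signature ℓ} (S : Structure L) where
  open Structure S renaming (refl to ≈-refl; sym to ≈-sym; trans to ≈-trans)

  ≈-isBisimulation : IsBisimulation S S _≈_
  ≈-isBisimulation = record
    { total      = λ x → x , ≈-refl
    ; surjective = λ x → x , ≈-refl
    ; ≈-resp     = λ x≈y x′≈y′ → mk⇔
        (λ x≈x′ → ≈-trans (≈-sym x≈y) (≈-trans x≈x′ x′≈y′))
        (λ y≈y′ → ≈-trans x≈y (≈-trans y≈y′ (≈-sym x′≈y′)))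
    ; func-resp  = func-cong
    ; rel-resp   = λ r v≈w → mk⇔ (rel-resp r v≈w) (rel-resp r (≈-sym ∘ v≈w))
    }

≡⇒elementaryEmbedding : {L : Signature ℓ} {S T : Structure L} → S ≡ T →
                       ∃ (IsElementaryEmbedding S T)
≡⇒elementaryEmbedding refl = id , λ _ _ → ⇔-id _

module _ {L : Signature ℓ} {S T : Structure L} {h : Structure.Carrier S → Structure.Carrier T}
         (h-elementary : IsElementaryEmbedding S T h) where
  private
    module S = Structure S
    module T = Structure T

  elementary-≈ : ∀ {x y} → x S.≈ y ⇔ h x T.≈ h y
  elementary-≈ {x} {y} = h-elementary (var Fin.zero ≈ᶠ var (Fin.suc Fin.zero)) (x ∷ y ∷ [])

  -- The formula `y = f(v)` is true in `S` when `y` is the value itself, and elementarity carries it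
  -- to `T`.
  elementary-func : ∀ f v → h (S.func f v) T.≈ T.func f (h ∘ v)
  elementary-func f v = Equivalence.to
    (h-elementary (var Fin.zero ≈ᶠ app f (var ∘ Fin.suc)) (S.func f v ∷ v)) S.refl

-- A structure coupled with a binary relation on a set N has carrier S × N; the
-- equality of the first components becomes a relation symbol, so that formulas about
-- S translate without relativising quantifiers.

data BinarySymbol : Set where
  equal₁ less₂ : BinarySymbol

Coupled : Signature ℓ → Signature ℓ
Coupled L = record
  { Func  = L.Func
  ; Rel   = L.Rel ⊎ BinarySymbol
  ; arity = L.arity
  ; rank  = [ L.rank , const 2 ]
  }
  where module L = Signature L

couple : {L : Signature ℓ} → Structure L → {N : Set ℓ} → N → Rel N ℓ → Structure (Coupled L)
couple S {N} n₀ _≺_ = record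
  { setoid    = S.setoid ×ₛ setoid N
  -- The second component is a dummy: translated formulas only read first components.
  ; func      = λ f v → S.func f (proj₁ ∘ v) , n₀
  ; rel       = λ
      { (inj₁ r)      v → S.rel r (proj₁ ∘ v)
      ; (inj₂ equal₁) v → proj₁ (v Fin.zero) S.≈ proj₁ (v (Fin.suc Fin.zero))
      ; (inj₂ less₂)  v → proj₂ (v Fin.zero) ≺ proj₂ (v (Fin.suc Fin.zero))
      }
  ; func-cong = λ f eq → S.func-cong f (proj₁ ∘ eq) , refl
  ; rel-resp  = λ
      { (inj₁ r)      eq → S.rel-resp r (proj₁ ∘ eq)
      ; (inj₂ equal₁) eq x≈y →
          S.trans (S.sym (proj₁ (eq Fin.zero))) (S.trans x≈y (proj₁ (eq (Fin.suc Fin.zero))))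
      ; (inj₂ less₂)  eq → subst₂ _≺_ (proj₂ (eq Fin.zero)) (proj₂ (eq (Fin.suc Fin.zero)))
      }
  }
  where module S = Structure S

module _ {L : Signature ℓ} where

  translateTerm : ∀ {n} → Term L n → Term (Coupled L) n
  translateTerm (var i)    = var i
  translateTerm (app f ts) = app f (translateTerm ∘ ts)

  translate : ∀ {n} → Formula L n → Formula (Coupled L) n
  translate (s ≈ᶠ t)    = relᶠ (inj₂ equal₁) (translateTerm s ∷ translateTerm t ∷ [])
  translate (relᶠ r ts) = relᶠ (inj₁ r) (translateTerm ∘ ts)
  translate ⊥ᶠ          = ⊥ᶠ
  translate (φ ⇒ᶠ ψ)    = translate φ ⇒ᶠ translate ψ
  translate (∀ᶠ φ)      = ∀ᶠ (translate φ)

module _ {L : Signature ℓ} (S : Structure L) {N : Set ℓ} (n₀ : N) (_≺_ : Rel N ℓ) where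
  open Structure S renaming (refl to ≈-refl; sym to ≈-sym; trans to ≈-trans)
  private
    S⁺ : Structure (Coupled L)
    S⁺ = couple S n₀ _≺_

    open IsBisimulation (≈-isBisimulation S) using (≈-resp) renaming (rel-resp to rel-resp-⇔)

  translateTerm-≈ : ∀ {n} (t : Term L n) {v w} → (∀ i → v i ≈ proj₁ (w i)) →
                    ⟦ S ⟧ t v ≈ proj₁ (⟦ S⁺ ⟧ (translateTerm t) w)
  translateTerm-≈ (var i)    v≈w = v≈w i
  translateTerm-≈ (app f ts) v≈w = func-cong f λ i → translateTerm-≈ (ts i) v≈w

  -- A quantifier over pairs amounts to one over first components: truth depends on these alone, and
  -- `n₀` completes each of them to a pair.
  translate-⇔ : ∀ {n} (φ : Formula L n) {v w} → (∀ i → v i ≈ proj₁ (w i)) →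
                Sat S φ v ⇔ Sat S⁺ (translate φ) w
  translate-⇔ (s ≈ᶠ t)    v≈w = ≈-resp (translateTerm-≈ s v≈w) (translateTerm-≈ t v≈w)
  translate-⇔ (relᶠ r ts) v≈w = rel-resp-⇔ r λ i → translateTerm-≈ (ts i) v≈w
  translate-⇔ ⊥ᶠ          v≈w = ⇔-id _
  translate-⇔ (φ ⇒ᶠ ψ)    v≈w = →-cong-⇔ (translate-⇔ φ v≈w) (translate-⇔ ψ v≈w)
  translate-⇔ (∀ᶠ φ) {v} {w} v≈w = mk⇔
    (λ f (x , n) → Equivalence.to (translate-⇔ φ (extend (x , n))) (f x))
    (λ f x → Equivalence.from (translate-⇔ φ (extend (x , n₀))) (f (x , n₀)))
    where
    extend : ∀ xn i → (proj₁ xn ∷ v) i ≈ proj₁ ((xn ∷ w) i)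
    extend xn Fin.zero    = ≈-refl
    extend xn (Fin.suc i) = v≈w i

module _ {L : Signature ℓ} {S T : Structure L} {M N : Set ℓ} {m₀ : M} {n₀ : N}
         {_≺₁_ : Rel M ℓ} {_≺₂_ : Rel N ℓ}
         {h : Structure.Carrier S × M → Structure.Carrier T × N}
         (h-elementary : IsElementaryEmbedding (couple S m₀ _≺₁_) (couple T n₀ _≺₂_) h) where

  -- Place `S` at level `m₀`, apply `h` to the translated formula, and project back to `T`.
  coupled-elementary₁ : IsElementaryEmbedding S T (λ x → proj₁ (h (x , m₀)))
  coupled-elementary₁ φ v =
    ⇔-sym (translate-⇔ T n₀ _≺₂_ φ (λ _ → Structure.refl T)) ⇔-∘
    (h-elementary (translate φ) (λ i → v i , m₀) ⇔-∘
     translate-⇔ S m₀ _≺₁_ φ (λ _ → Structure.refl S))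

  coupled-monotone₂ : ∀ x p q → p ≺₁ q → proj₂ (h (x , p)) ≺₂ proj₂ (h (x , q))
  coupled-monotone₂ x p q = Equivalence.to
    (h-elementary (relᶠ (inj₂ less₂) var) ((x , p) ∷ (x , q) ∷ []))

-- Modules

module _ {R : Ring ℓ ℓ} where

  elementary⇒monomorphism :
    {M N : LeftModule R ℓ ℓ} {h : LeftModule.Carrierᴹ M → LeftModule.Carrierᴹ N} →
    IsElementaryEmbedding (asStructure M) (asStructure N) h →
    IsLeftModuleMonomorphism (LeftModule.rawLeftModule M) (LeftModule.rawLeftModule N) h
  elementary⇒monomorphism {M} {N} {h} h-elementary = record
    { isLeftModuleHomomorphism = record
      { +ᴹ-isGroupHomomorphism = record
        { isMonoidHomomorphism = record
          { isMagmaHomomorphism = record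
            { isRelHomomorphism = record { cong = Equivalence.to (elementary-≈ h-elementary) }
            ; homo              = λ x y → elementary-func h-elementary plus (x ∷ y ∷ [])
            }
          ; ε-homo = elementary-func {h = h} h-elementary zero []
          }
        ; ⁻¹-homo = λ x → elementary-func h-elementary neg (x ∷ [])
        }
      ; *ₗ-homo = λ r x → elementary-func h-elementary (scale r) (x ∷ [])
      }
    ; injective = Equivalence.from (elementary-≈ h-elementary)
    }

  module _ {M N : LeftModule R ℓ ℓ} where
    private
      module M = LeftModule M
      module N = LeftModule N

    module _ {h : M.Carrierᴹ → N.Carrierᴹ}
             (h-mono : IsLeftModuleMonomorphism M.rawLeftModule N.rawLeftModule h) where
      private module h = IsLeftModuleMonomorphism h-mono

      image : Submodule N
      image = record
        { member    = λ y → ∃[ x ] h x N.≈ᴹ y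
        ; resp      = λ y≈z (x , hx≈y) → x , N.≈ᴹ-trans hx≈y y≈z
        ; +ᴹ-closed = λ (x , hx≈y) (x′ , hx′≈y′) →
            x M.+ᴹ x′ , N.≈ᴹ-trans (h.+ᴹ-homo x x′) (N.+ᴹ-cong hx≈y hx′≈y′)
        ; 0ᴹ-closed = M.0ᴹ , h.0ᴹ-homo
        ; -ᴹ-closed = λ (x , hx≈y) → M.-ᴹ x , N.≈ᴹ-trans (h.-ᴹ-homo x) (N.-ᴹ‿cong hx≈y)
        ; *ₗ-closed = λ r (x , hx≈y) →
            r M.*ₗ x , N.≈ᴹ-trans (h.*ₗ-homo r x) (N.*ₗ-congˡ hx≈y)
        }

      toImage : M.Carrierᴹ → LeftModule.Carrierᴹ ⌊ image ⌋
      toImage x = h x , x , N.≈ᴹ-refl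

      toImage-iso : IsLeftModuleIsomorphism M.rawLeftModule (LeftModule.rawLeftModule ⌊ image ⌋)
                                            toImage
      toImage-iso = record
        { isLeftModuleMonomorphism = record
          { isLeftModuleHomomorphism = record
            { +ᴹ-isGroupHomomorphism = record
              { isMonoidHomomorphism = record
                { isMagmaHomomorphism = record
                  { isRelHomomorphism = record { cong = h.⟦⟧-cong }
                  ; homo              = h.+ᴹ-homo
                  }
                ; ε-homo = h.0ᴹ-homo
                }
              ; ⁻¹-homo = h.-ᴹ-homo
              }
            ; *ₗ-homo = h.*ₗ-homo
            }
          ; injective = h.injective
          }
        ; surjective = λ (y , x , hx≈y) → x , λ z≈x → N.≈ᴹ-trans (h.⟦⟧-cong z≈x) hx≈y
        }

    -- Transport of satisfaction and of vanishing Ext along an isomorphism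

    module _ {h : M.Carrierᴹ → N.Carrierᴹ}
             (h-iso : IsLeftModuleIsomorphism M.rawLeftModule N.rawLeftModule h) where
      private module h = IsLeftModuleIsomorphism h-iso

      isomorphism-isBisimulation :
        IsBisimulation (asStructure M) (asStructure N) (λ x y → h x N.≈ᴹ y)
      isomorphism-isBisimulation = record
        { total      = λ x → h x , N.≈ᴹ-refl
        ; surjective = λ y → let (x , hx≈y) = h.surjective y in x , hx≈y M.≈ᴹ-refl
        ; ≈-resp     = λ hx≈y hx′≈y′ → mk⇔
            (λ x≈x′ → N.≈ᴹ-trans (N.≈ᴹ-sym hx≈y) (N.≈ᴹ-trans (h.⟦⟧-cong x≈x′) hx′≈y′))
            (λ y≈y′ → h.injective (N.≈ᴹ-trans hx≈y (N.≈ᴹ-trans y≈y′ (N.≈ᴹ-sym hx′≈y′))))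
        ; func-resp  = λ
            { plus eq      → N.≈ᴹ-trans (h.+ᴹ-homo _ _) (N.+ᴹ-cong (eq Fin.zero) (eq (Fin.suc Fin.zero)))
            ; zero eq      → h.0ᴹ-homo
            ; neg eq       → N.≈ᴹ-trans (h.-ᴹ-homo _) (N.-ᴹ‿cong (eq Fin.zero))
            ; (scale r) eq → N.≈ᴹ-trans (h.*ₗ-homo r _) (N.*ₗ-congˡ (eq Fin.zero))
            }
        ; rel-resp   = λ ()
        }

      -- Composing the projection with `h` gives an extension of `N` with the same middle module.
      -- Its splitting supplies the `C` coordinate, and the original projection replaces the `N`
      -- coordinate, which is `h ∘ proj`.
      Ext¹≈0-iso : (C : LeftModule R ℓ ℓ) → Ext¹≈0 N C → Ext¹≈0 M C
      Ext¹≈0-iso C vanish 𝓔 = record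
        { to      = λ e → proj₁ (to e) , proj e
        ; to-iso  = record
          { isLeftModuleMonomorphism = record
            { isLeftModuleHomomorphism = record
              { +ᴹ-isGroupHomomorphism = record
                { isMonoidHomomorphism = record
                  { isMagmaHomomorphism = record
                    { isRelHomomorphism = record
                      { cong = λ eq → proj₁ (I.⟦⟧-cong eq) , P.⟦⟧-cong eq }
                    ; homo = λ x y → proj₁ (I.+ᴹ-homo x y) , P.+ᴹ-homo x y
                    }
                  ; ε-homo = proj₁ I.0ᴹ-homo , P.0ᴹ-homo
                  }
                ; ⁻¹-homo = λ x → proj₁ (I.-ᴹ-homo x) , P.-ᴹ-homo x
                }
              ; *ₗ-homo = λ r x → proj₁ (I.*ₗ-homo r x) , P.*ₗ-homo r x
              }
            ; injective = λ {x} {y} (to≈ , proj≈) → I.injective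
                (to≈ , N.≈ᴹ-trans (proj-to x) (N.≈ᴹ-trans (h.⟦⟧-cong proj≈) (N.≈ᴹ-sym (proj-to y))))
            }
          -- A preimage of `(c , h x)` under the splitting works, as injectivity of `h` recovers
          -- `x`.
          ; surjective = λ (c , x) →
              let (e , to≈) = I.surjective (c , h x)
                  hproj≈hx  = N.≈ᴹ-trans (N.≈ᴹ-sym (proj-to e)) (proj₂ (to≈ E.≈ᴹ-refl))
              in e , λ z≈e → proj₁ (to≈ z≈e)
                           , M.≈ᴹ-trans (P.⟦⟧-cong z≈e) (h.injective hproj≈hx)
          }
        ; to-incl = λ c → proj₁ (to-incl c) , proj∘incl c
        ; proj-to = λ _ → M.≈ᴹ-refl
        }
        where
        open Extension 𝓔
        module E = LeftModule middle
        module P = IsLeftModuleHomomorphism proj-hom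

        pushed : Extension N C
        pushed = record
          { middle      = middle
          ; incl        = incl
          ; incl-mono   = incl-mono
          ; proj        = h ∘ proj
          ; proj-hom    = Composition.isLeftModuleHomomorphism N.≈ᴹ-trans
                            proj-hom h.isLeftModuleHomomorphism
          ; proj-surj   = λ y →
              let (x , hx≈y)     = h.surjective y
                  (e , proje≈x) = proj-surj x
              in e , hx≈y proje≈x
          ; proj∘incl   = λ c → N.≈ᴹ-trans (h.⟦⟧-cong (proj∘incl c)) h.0ᴹ-homo
          ; ker-proj⊆im = λ e eq → ker-proj⊆im e (h.injective (N.≈ᴹ-trans eq (N.≈ᴹ-sym h.0ᴹ-homo)))
          }

        open Equivalent (vanish pushed) using (to; to-iso; to-incl; proj-to)
        module I = IsLeftModuleIsomorphism to-iso

  -- Elementary embeddings and their images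

  module _ {M N : LeftModule R ℓ ℓ} {h : LeftModule.Carrierᴹ M → LeftModule.Carrierᴹ N}
           (h-elementary : IsElementaryEmbedding (asStructure M) (asStructure N) h) where
    private
      module M = LeftModule M
      module N = LeftModule N

      h-mono : IsLeftModuleMonomorphism M.rawLeftModule N.rawLeftModule h
      h-mono = elementary⇒monomorphism {M = M} {N} h-elementary

    elementaryImage : Submodule N
    elementaryImage = image {M} {N} h-mono

    private
      image-iso : IsLeftModuleIsomorphism M.rawLeftModule (LeftModule.rawLeftModule ⌊ elementaryImage ⌋)
                                          (toImage {M} {N} h-mono)
      image-iso = toImage-iso {M} {N} h-mono

      image-isBisimulation : IsBisimulation (asStructure M) (asStructure ⌊ elementaryImage ⌋)
                                            (λ x y → h x N.≈ᴹ proj₁ y)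
      image-isBisimulation = isomorphism-isBisimulation {M} {⌊ elementaryImage ⌋} image-iso

    -- Each point of the image carries a preimage. Pull the tuple back to `M` along the isomorphism,
    -- push it forward by `h`, and correct the result up to equality in `N`.
    elementaryImage-isElementary : IsElementary elementaryImage
    elementaryImage-isElementary φ v =
      IsBisimulation.Sat-resp (≈-isBisimulation (asStructure N)) φ (λ i → proj₂ (proj₂ (v i))) ⇔-∘
      (h-elementary φ (λ i → proj₁ (proj₂ (v i))) ⇔-∘
       ⇔-sym (IsBisimulation.Sat-resp image-isBisimulation φ
               (λ i → proj₂ (proj₂ (v i)))))

    -- Downward closure passes vanishing from `N` to the image of `h`, which is isomorphic to `M`.
    Ext¹≈0-reflected : {C : LeftModule R ℓ ℓ} → DownwardClosed (^⊥ ｛ C ｝) → Ext¹≈0 N C → Ext¹≈0 M C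
    Ext¹≈0-reflected {C} closed vanish = Ext¹≈0-iso {M} {⌊ elementaryImage ⌋} image-iso C
      (closed (λ { refl → vanish }) elementaryImage elementaryImage-isElementary refl)

-- The sequence of nonvanishing pairs and Vopěnka's Principle

module _ (em : ∀ {a} → ExcludedMiddle a) (ext : ∀ {a b} → Extensionality a b)
         {R : Ring ℓ ℓ} (𝓑 : Class (LeftModule R ℓ ℓ)) where
  open CanonicalTree em ext {ℓ}

  record NonvanishingPair : Set (suc ℓ) where
    field
      X         : LeftModule R ℓ ℓ
      B         : LeftModule R ℓ ℓ
      B∈𝓑       : 𝓑 B
      nonvanish : ¬ Ext¹≈0 X B

  open NonvanishingPair

  -- If no such pair existed, every module orthogonal to all `B (F i)` would be orthogonal to all of
  -- `𝓑`, so these modules would be the desired set.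
  nextPair :
    ¬ (Σ[ 𝓑₀ ∈ Class (LeftModule R ℓ ℓ) ] IsSet 𝓑₀ × 𝓑₀ ⊆ 𝓑 × ^⊥ 𝓑 ≐ ^⊥ 𝓑₀) →
    {I : Set ℓ} (F : I → NonvanishingPair) → ∃[ x ] ∀ i → Ext¹≈0 (X x) (B (F i))
  nextPair ¬small {I} F = em⇒dne em λ ¬next → ¬small
    ( (λ C → ∃[ i ] B (F i) ≡ C)
    , (I , B ∘ F , id , id)
    , (λ { (i , refl) → B∈𝓑 (F i) })
    , (λ Y∈ {_} → λ { (i , refl) → Y∈ (B∈𝓑 (F i)) })
    , λ {Y} Y∈ {C} C∈𝓑 → em⇒dne em λ Ext≢0 → ¬next
        (record { X = Y ; B = C ; B∈𝓑 = C∈𝓑 ; nonvanish = Ext≢0 } , λ i → Y∈ (i , refl))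
    )

  module CoupledSequence
    (x : Tree ℓ → NonvanishingPair)
    (vanish : ∀ s t → s < t → Ext¹≈0 (X (x t)) (B (x (rep s))))
    where

    coupled : Tree ℓ → Structure (Coupled (ModuleSignature R))
    coupled t = couple (asStructure (X (x t))) (root t) (NodeLess t)

    -- Restricting to representatives leaves one structure per rank, so distinct members have
    -- different ranks.
    CoupledClass : Class (Structure (Coupled (ModuleSignature R)))
    CoupledClass S = ∃[ t ] coupled (rep t) ≡ S

    embedding⇒≤ : ∀ s t → ∃ (IsElementaryEmbedding (coupled s) (coupled t)) → s ≤ t
    embedding⇒≤ s t (h , h-elementary) = nodeEmbedding⇒≤ s t
      (λ p → proj₂ (h (LeftModule.0ᴹ (X (x s)) , p)))
      (coupled-monotone₂ {S = asStructure (X (x s))} {asStructure (X (x t))} {h = h} h-elementary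
        (LeftModule.0ᴹ (X (x s))))

    isProper : IsProper CoupledClass
    isProper = unboundedRange-isProper (coupled ∘ rep) rep (proj₁ ∘ ≈-rep)
      -- Equal structures embed by the identity, which already bounds the rank.
      λ {s} {t} eq → embedding⇒≤ (rep s) (rep t) (≡⇒elementaryEmbedding eq)

    <⇒¬embedding : (∀ {B} → 𝓑 B → DownwardClosed (^⊥ ｛ B ｝)) → ∀ s t → rep s < t →
                   ¬ ∃ (IsElementaryEmbedding (coupled (rep s)) (coupled t))
    <⇒¬embedding closed s t s<t (h , h-elementary) = nonvanish (x (rep s))
      (Ext¹≈0-reflected {M = X (x (rep s))} {X (x t)} {λ y → proj₁ (h (y , root (rep s)))}
        (coupled-elementary₁ {S = asStructure (X (x (rep s)))} {asStructure (X (x t))} {h = h}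
          h-elementary)
        (closed (B∈𝓑 (x (rep s))))
        (vanish s t (≤-<-trans s (rep s) t (proj₁ (≈-rep s)) s<t)))

    -- The node orders rule out embedding a higher rank into a lower one, equal ranks give equal
    -- structures, and a strict increase contradicts nonvanishing.
    CoupledClass-¬embedding :
      (∀ {B} → 𝓑 B → DownwardClosed (^⊥ ｛ B ｝)) → ∀ {S T} → CoupledClass S → CoupledClass T → S ≢ T →
      ¬ ∃ (IsElementaryEmbedding S T)
    CoupledClass-¬embedding closed (s , refl) (t , refl) S≢T embedding =
      [ (λ t≤s → S≢T (cong coupled (rep-injective (embedding⇒≤ (rep s) (rep t) embedding) t≤s)))
      , (λ s<t → <⇒¬embedding closed s (rep t) s<t embedding)
      ] (≤-or-> (rep t) (rep s))

  ¬vanishingSequence :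
    VopěnkaPrinciple ℓ → (∀ {B} → 𝓑 B → DownwardClosed (^⊥ ｛ B ｝)) →
    ¬ (Σ[ x ∈ (Tree ℓ → NonvanishingPair) ] (∀ s t → s < t → Ext¹≈0 (X (x t)) (B (x (rep s)))))
  ¬vanishingSequence vp closed (x , vanish) =
    let (_ , _ , S∈ , T∈ , S≢T , embedding) = vp _ CoupledClass isProper
    in CoupledClass-¬embedding closed S∈ T∈ S≢T embedding
    where open CoupledSequence x vanish

  smallSubclass :
    VopěnkaPrinciple ℓ → (∀ {B} → 𝓑 B → DownwardClosed (^⊥ ｛ B ｝)) →
    Σ[ 𝓑₀ ∈ Class (LeftModule R ℓ ℓ) ] IsSet 𝓑₀ × 𝓑₀ ⊆ 𝓑 × ^⊥ 𝓑 ≐ ^⊥ 𝓑₀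
  smallSubclass vp closed = em⇒dne em λ ¬small →
    ¬vanishingSequence vp closed
      (transfiniteChoice (λ x y → Ext¹≈0 (X x) (B y)) (nextPair ¬small))

theorem1p3 : (∀ {a} → ExcludedMiddle a) →
    (∀ {a b} → Extensionality a b) →
    ∀ {ℓ} → VopěnkaPrinciple ℓ →
    (R : Ring ℓ ℓ) (𝓑 : Class (LeftModule R ℓ ℓ)) →
    (∀ {B} → 𝓑 B → DownwardClosed (^⊥ ｛ B ｝)) →
    Σ[ 𝓑₀ ∈ Class (LeftModule R ℓ ℓ) ] IsSet 𝓑₀ × 𝓑₀ ⊆ 𝓑 × ^⊥ 𝓑 ≐ ^⊥ 𝓑₀
theorem1p3 em ext vp _ 𝓑 closed = smallSubclass em ext 𝓑 vp closed
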